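{- Let $r,\ell,k$ be integers with $r\ge 3$, $2\le \ell\le r$ and $k\ge 1+r-\ell$. Then $$\mathrm{cov}(r,\ell,k)\le 1+\Bigl\lfloor \frac{k-r+\ell-1}{\ell}\Bigr\rfloor .$$
   Context: For $1\le\ell\le r$, a hypergraph is complete $r$-uniform $(r,\ell)$-partite if its vertex set $V$ is partitioned into $r$ nonempty classes $V_1\cup\dots\cup V_r$ and its edge set consists of all $r$-element subsets of $V$ that intersect each class in at most $\ell$ vertices. A $k$-coloring of a hypergraph is an assignment of a color from $[k]=\{1,\dots,k\}$ to each edge (not all $k$ colors need be used). A coloring is spanning if every vertex is incident to edges of every color used in the coloring. For an edge-colored hypergraph $H$, let $H_i$ be the subhypergraph on vertex set $V(H)$ consisting of the edges of color $i$. A hypergraph is connected if it has only one vertex or any two distinct vertices can be connected by a sequence of edges each intersecting the next; every hypergraph is uniquely partitioned into connected components. A monochromatic component of $H$ is (the vertex set of) a connected component of $H_i$ for some color $i$. $\mathrm{cov}(r,\ell,k)$ is the minimum integer $m$ such that for every complete $r$-uniform $(r,\ell)$-partite hypergraph and every spanning $k$-coloring of its edges, the vertex set can be covered by at most $m$ monochromatic components. -}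

module Defs where

open import Data.Nat.Base using (ℕ; _≤_)
open import Data.Fin.Base using (Fin)
open import Data.Fin.Properties using (_≟_)
open import Data.Fin.Subset using (Subset; _∈_; _∩_; ∣_∣; Nonempty)
open import Data.List.Base using (List; length)
open import Data.List.Relation.Unary.All using (All)
open import Data.List.Relation.Unary.Any using (Any)
open import Data.Product.Base using (Σ-syntax; ∃; _×_; proj₁)
open import Data.Sum.Base using (_⊎_)
open import Data.Vec.Base using (tabulate)
open import Function.Bundles using (_⇔_)
open import Function.Definitions using (StrictlySurjective)
open import Level using (0ℓ)
open import Relation.Binary.Construct.Closure.ReflexiveTransitive using (Star)
open import Relation.Binary.PropositionalEquality.Core using (_≡_)
open import Relation.Nullary.Decidable.Core using (does)
open import Relation.Unary using (Pred)

-- Vertex set Fin n; the predicate is the edge set.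
Hypergraph : ℕ → Set₁
Hypergraph n = Pred (Subset n) 0ℓ

module _ {n : ℕ} (H : Hypergraph n) where

  Edge : Set
  Edge = ∃ H

  Meets : Edge → Edge → Set
  Meets e f = Nonempty (proj₁ e ∩ proj₁ f)

  -- Distinct vertices must lie in the first and the last edge of a sequence
  -- of edges each meeting the next; an isolated vertex is only joined to itself.
  Joined : Fin n → Fin n → Set
  Joined u v = u ≡ v ⊎
    (Σ[ e ∈ Edge ] Σ[ f ∈ Edge ] u ∈ proj₁ e × v ∈ proj₁ f × Star Meets e f)

  IsComponent : Subset n → Set
  IsComponent C = Nonempty C × (∀ u v → u ∈ C → (v ∈ C ⇔ Joined u v))

-- A partition into r classes is given by the map sending a vertex to the index
-- of its class; the classes are nonempty when this map is surjective.
class : ∀ {n r} → (Fin n → Fin r) → Fin r → Subset n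
class part i = tabulate (λ v → does (part v ≟ i))

CompletePartite : ∀ {n r} → ℕ → (Fin n → Fin r) → Hypergraph n
CompletePartite {r = r} ℓ part e =
  ∣ e ∣ ≡ r × (∀ i → ∣ e ∩ class part i ∣ ≤ ℓ)

-- The membership proof is irrelevant so that a colour depends on the edge only.
Colouring : ∀ {n} → Hypergraph n → ℕ → Set
Colouring {n} H k = (e : Subset n) → .(H e) → Fin k

module _ {n k : ℕ} {H : Hypergraph n} (c : Colouring H k) where

  colourClass : Fin k → Hypergraph n
  colourClass i e = Σ[ p ∈ H e ] c e p ≡ i

  Spanning : Set
  Spanning = ∀ i → ∃ (colourClass i) →
             ∀ v → ∃ λ e → colourClass i e × v ∈ e

  IsMonochromaticComponent : Subset n → Set
  IsMonochromaticComponent C = ∃ λ i → IsComponent (colourClass i) C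

  CoveredBy : ℕ → Set
  CoveredBy m = Σ[ Cs ∈ List (Subset n) ]
    length Cs ≤ m × All IsMonochromaticComponent Cs × (∀ v → Any (v ∈_) Cs)

AlwaysCoveredBy : (r ℓ k m : ℕ) → Set
AlwaysCoveredBy r ℓ k m =
  ∀ {n} (part : Fin n → Fin r) → StrictlySurjective _≡_ part →
  (c : Colouring (CompletePartite ℓ part) k) → Spanning c → CoveredBy c m

-- m = cov(r,ℓ,k).  A relation rather than a function, because the existence of
-- a least element of an inhabited set of naturals is not constructive.
IsCov : (r ℓ k m : ℕ) → Set
IsCov r ℓ k m =
  AlwaysCoveredBy r ℓ k m × (∀ m′ → AlwaysCoveredBy r ℓ k m′ → m ≤ m′)

{-# OPTIONS --safe #-}
-- Let q be the claimed bound, so that k ≤ ℓ q + (r − ℓ), and suppose that no q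
-- monochromatic components cover.  Then for every vertex s and every set of at
-- most q colours some vertex is outside the components of s in all these colours.
-- It suffices to find a set of at most r vertices, at most ℓ in each class,
-- which is separated in every colour: an edge containing it could have no colour.
--
-- Among the pairs u, v from different classes take one joined in as few colours
-- as possible, and let B be the set of these colours.  If ∣B∣ ≤ q, a vertex w
-- outside the components of u in the colours of B completes u, v to such a set.
-- Otherwise take w outside the components of u in q colours of B.  Counting
-- colours, joined(u,w) + joined(v,w) + 2q ≤ k + ∣B∣, and w is in a different
-- class from u or from v, so by minimality one of the pairs u, w and v, w is
-- separated in 2q colours.  Adding ℓ − 2 arbitrary vertices disposes of q
-- further colours each.  The remaining at most r − ℓ colours are treated one by
-- one: in a colour in which s is not isolated, an edge missing the component of s
-- has r vertices, and one of them can be added by matroid exchange.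
module Submission where

open import Data.Nat using (ℕ; _+_; _∸_; _≤_; _≥_; NonZero)
open import Data.Nat.DivMod using (_/_)
open import Data.Product using (_×_)
open import Defs

open import Data.Bool.Base using (Bool; if_then_else_)
open import Data.Empty using (⊥-elim)
open import Data.Fin.Base using (Fin; zero; suc)
import Data.Fin.Properties as Fin
open import Data.Fin.Subset as Subset
  using (Subset; _∈_; _∉_; _∩_; _∪_; ∣_∣; ⁅_⁆; _⊆_; inside; outside)
open import Data.Fin.Subset.Properties
  using ( _∈?_; x∈p∩q⁺; x∈p∩q⁻; x∈p∪q⁺; x∈p∪q⁻; x∈⁅x⁆; x∈⁅y⁆⇒x≡y; ∈⊤; ∪-identityʳ
        ; p⊆q⇒∣p∣≤∣q∣; p⊂q⇒∣p∣<∣q∣; ∣p∩q∣≤∣p∣; x∈p⇒∣p-x∣<∣p∣; x∈p∧x≢y⇒x∈p-y; p⊆p∪q; ∣⁅x⁆∣≡1)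
open import Data.List.Base as List
  using (List; []; _∷_; _++_; length; filter; take; drop; allFin)
import Data.List.Properties as List
import Data.List.Membership.Propositional as List
open import Data.List.Membership.Propositional.Properties
  using (∈-++⁺ˡ; ∈-++⁺ʳ; ∈-++⁻; ∈-map⁺; ∈-filter⁺; ∈-allFin)
open import Data.List.Relation.Binary.Permutation.Propositional
  using (_↭_; ↭-refl; ↭-sym; ↭-trans; prep)
open import Data.List.Relation.Binary.Permutation.Propositional.Properties
  using (shift; ↭-length; filter-↭)
open import Data.List.Relation.Unary.All as All using (All; []; _∷_)
import Data.List.Relation.Unary.All.Properties as All
open import Data.List.Relation.Unary.Any as Any using (Any; here; there)
import Data.List.Relation.Unary.Any.Properties as Any
open import Data.Nat.Base using (suc; zero; _*_; _<_; z≤n; s≤s)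
open import Data.Nat.DivMod using (_%_; m≡m%n+[m/n]*n; m%n<n)
open import Data.Nat.Induction using (Acc; acc; <-wellFounded)
open import Data.Nat.Properties hiding (_≟_)
import Data.Nat.Properties as ℕ
open import Data.Nat.Tactic.RingSolver using (solve-∀)
open import Data.Product using (∃; ∃₂; _,_; proj₁; proj₂)
open import Data.Sum using (_⊎_; inj₁; inj₂; [_,_]′)
open import Data.Vec.Base as Vec using (tabulate)
open import Data.Vec.Properties using (lookup∘tabulate; lookup⇒[]=; []=⇒lookup)
open import Function.Base using (_∘_; id)
open import Function.Bundles using (mk⇔)
open import Function.Definitions using (StrictlySurjective)
open import Level using (0ℓ)
open import Relation.Binary.Construct.Closure.ReflexiveTransitive using (Star; ε; _◅_; _◅◅_)
open import Relation.Binary.PropositionalEquality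
open import Relation.Nullary using (¬_; Dec; yes; no; does; contradiction; ¬?)
open import Relation.Nullary.Decidable using (_×-dec_; _⊎-dec_; dec-true)
open import Relation.Unary using (Pred; Decidable)

open import Algebra.Properties.CommutativeMonoid.Sum +-0-commutativeMonoid
  using (sum; ∑-distrib-+; sum-cong-≗; sum-replicate-zero)

-- Finite subsets and finite sums

∈-tabulate-does⁺ : ∀ {n} {P : Pred (Fin n) 0ℓ} (P? : Decidable P) {v} →
                   P v → v ∈ tabulate (does ∘ P?)
∈-tabulate-does⁺ P? {v} pv =
  lookup⇒[]= v _ (trans (lookup∘tabulate (does ∘ P?) v) (dec-true (P? v) pv))

∈-tabulate-does⁻ : ∀ {n} {P : Pred (Fin n) 0ℓ} (P? : Decidable P) {v} →
                   v ∈ tabulate (does ∘ P?) → P v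
∈-tabulate-does⁻ P? {v} v∈
  with P? v | trans (sym (lookup∘tabulate (does ∘ P?) v)) ([]=⇒lookup v∈)
... | yes pv | _ = pv

∣p∪⁅x⁆∣≤1+∣p∣ : ∀ {n} (p : Subset n) x → ∣ p ∪ ⁅ x ⁆ ∣ ≤ suc ∣ p ∣
∣p∪⁅x⁆∣≤1+∣p∣ (inside  Vec.∷ p) zero    rewrite ∪-identityʳ p = n≤1+n _
∣p∪⁅x⁆∣≤1+∣p∣ (outside Vec.∷ p) zero    rewrite ∪-identityʳ p = ≤-refl
∣p∪⁅x⁆∣≤1+∣p∣ (inside  Vec.∷ p) (suc x) = s≤s (∣p∪⁅x⁆∣≤1+∣p∣ p x)
∣p∪⁅x⁆∣≤1+∣p∣ (outside Vec.∷ p) (suc x) = ∣p∪⁅x⁆∣≤1+∣p∣ p x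

x∉p⇒∣p∪⁅x⁆∣≡1+∣p∣ : ∀ {n} {p : Subset n} {x} → x ∉ p → ∣ p ∪ ⁅ x ⁆ ∣ ≡ suc ∣ p ∣
x∉p⇒∣p∪⁅x⁆∣≡1+∣p∣ {p = p} {x} x∉p = ≤-antisym (∣p∪⁅x⁆∣≤1+∣p∣ p x)
  (p⊂q⇒∣p∣<∣q∣ (p⊆p∪q _ , x , x∈p∪q⁺ (inj₂ (x∈⁅x⁆ x)) , x∉p))

subsets : ∀ n → List (Subset n)
subsets zero    = Vec.[] ∷ []
subsets (suc n) = List.map (inside Vec.∷_) (subsets n) ++ List.map (outside Vec.∷_) (subsets n)

∈-subsets : ∀ {n} (p : Subset n) → p List.∈ subsets n
∈-subsets Vec.[]              = here refl
∈-subsets (inside  Vec.∷ p) = ∈-++⁺ˡ (∈-map⁺ _ (∈-subsets p))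
∈-subsets (outside Vec.∷ p) = ∈-++⁺ʳ _ (∈-map⁺ _ (∈-subsets p))

sum-mono : ∀ {r} {f g : Fin r → ℕ} → (∀ i → f i ≤ g i) → sum f ≤ sum g
sum-mono {zero}  f≤g = z≤n
sum-mono {suc r} f≤g = +-mono-≤ (f≤g zero) (sum-mono (f≤g ∘ suc))

sum-const-1 : ∀ r → sum {r} (λ _ → 1) ≡ r
sum-const-1 zero    = refl
sum-const-1 (suc r) = cong suc (sum-const-1 r)

indicator : Bool → ℕ
indicator b = if b then 1 else 0

sum-indicator : ∀ {r} (j : Fin r) → sum (λ i → indicator (does (j Fin.≟ i))) ≡ 1
sum-indicator {suc r} zero    = cong suc (sum-replicate-zero r)
sum-indicator {suc r} (suc j) = sum-indicator j

∣∷∣ : ∀ {n} b (p : Subset n) → ∣ b Vec.∷ p ∣ ≡ indicator b + ∣ p ∣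
∣∷∣ inside  p = refl
∣∷∣ outside p = refl

-- Double counting by induction on the vertices: the first vertex, if it is in `p`, adds 1 to
-- exactly one class.
sum-∩-class : ∀ {n r} (part : Fin n → Fin r) (p : Subset n) →
              sum (λ i → ∣ p ∩ class part i ∣) ≡ ∣ p ∣
sum-∩-class {r = r} part Vec.[]            = sum-replicate-zero r
sum-∩-class         part (outside Vec.∷ p) = sum-∩-class (part ∘ suc) p
sum-∩-class {r = r} part (inside  Vec.∷ p) = begin
  sum (λ i → ∣ (inside Vec.∷ p) ∩ class part i ∣)
    ≡⟨ sum-cong-≗ (λ i → ∣∷∣ (does (part zero Fin.≟ i)) (p ∩ class (part ∘ suc) i)) ⟩
  sum (λ i → indicator (does (part zero Fin.≟ i)) + ∣ p ∩ class (part ∘ suc) i ∣)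
    ≡⟨ ∑-distrib-+ (λ i → indicator (does (part zero Fin.≟ i))) _ ⟩
  sum (λ i → indicator (does (part zero Fin.≟ i))) + sum (λ i → ∣ p ∩ class (part ∘ suc) i ∣)
    ≡⟨ cong₂ _+_ (sum-indicator (part zero)) (sum-∩-class (part ∘ suc) p) ⟩
  suc ∣ p ∣ ∎
  where
  open ≡-Reasoning

-- Counting list entries with decidable properties

module _ {a} {A : Set a} where

  count : {P : Pred A 0ℓ} → Decidable P → List A → ℕ
  count P? xs = length (filter P? xs)

  split-filter : ∀ {R : Pred A 0ℓ} (R? : Decidable R) q xs → q ≤ count R? xs →
                 ∃₂ λ ys zs → xs ↭ ys ++ zs × length ys ≡ q × All R ys
  split-filter R? zero xs q≤ = [] , xs , ↭-refl , refl , []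
  split-filter R? (suc q) (x ∷ xs) q≤ with R? x
  ... | yes rx with ys , zs , σ , eq , rys ← split-filter R? q xs (≤-pred q≤) =
    x ∷ ys , zs , prep x σ , cong suc eq , rx ∷ rys
  ... | no _ with ys , zs , σ , eq , rys ← split-filter R? (suc q) xs q≤ =
    ys , x ∷ zs , ↭-trans (prep x σ) (↭-sym (shift x ys zs)) , eq , rys

  module _ {P Q R : Pred A 0ℓ} (P? : Decidable P) (Q? : Decidable Q) (R? : Decidable R)
           (P∩Q⊆R : ∀ {x} → P x → Q x → R x) where

    -- Inclusion-exclusion, with the union bounded by the whole list.
    count-∩ : ∀ xs → count P? xs + count Q? xs ≤ length xs + count R? xs
    count-∩ [] = z≤n
    count-∩ (x ∷ xs) with ih ← count-∩ xs | P? x | Q? x | R? x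
    ... | yes p | yes q | no ¬r = contradiction (P∩Q⊆R p q) ¬r
    ... | yes _ | yes _ | yes _ = s≤s (≤-trans (≤-reflexive (+-suc _ _))
                                    (≤-trans (s≤s ih) (≤-reflexive (sym (+-suc _ _)))))
    ... | yes _ | no _  | yes _ = s≤s (≤-trans ih (+-monoʳ-≤ _ (n≤1+n _)))
    ... | yes _ | no _  | no _  = s≤s ih
    ... | no _  | yes _ | yes _ = ≤-trans (≤-reflexive (+-suc _ _))
                                    (s≤s (≤-trans ih (+-monoʳ-≤ _ (n≤1+n _))))
    ... | no _  | yes _ | no _  = ≤-trans (≤-reflexive (+-suc _ _)) (s≤s ih)
    ... | no _  | no _  | yes _ = m≤n⇒m≤1+n (≤-trans ih (+-monoʳ-≤ _ (n≤1+n _)))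
    ... | no _  | no _  | no _  = m≤n⇒m≤1+n ih

    -- Each entry of `ys` counts twice on the right, in the length and under `R`, but never under
    -- `P` or `Q`; `count-∩` handles `zs`.
    count-∩-split : ∀ {xs ys zs} → xs ↭ ys ++ zs → All R ys →
                    All (¬_ ∘ P) ys → All (¬_ ∘ Q) ys →
                    count P? xs + count Q? xs + (length ys + length ys) ≤ length xs + count R? xs
    count-∩-split {xs} {ys} {zs} σ rys ¬pys ¬qys = begin
      count P? xs + count Q? xs + (y + y) ≡⟨ cong₂ (λ a b → a + b + (y + y)) (none P? ¬pys) (none Q? ¬qys) ⟩
      count P? zs + count Q? zs + (y + y) ≤⟨ +-monoˡ-≤ (y + y) (count-∩ zs) ⟩
      length zs + count R? zs + (y + y)   ≡⟨ rearrange (length zs) (count R? zs) y ⟩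
      (y + length zs) + (y + count R? zs) ≡⟨ cong₂ _+_ len≡ R≡ ⟨
      length xs + count R? xs             ∎
      where
      open ≤-Reasoning
      y = length ys
      rearrange : ∀ a b y → a + b + (y + y) ≡ (y + a) + (y + b)
      rearrange = solve-∀
      none : ∀ {S : Pred A 0ℓ} (S? : Decidable S) → All (¬_ ∘ S) ys → count S? xs ≡ count S? zs
      none S? ¬sys = trans (↭-length (filter-↭ S? σ))
        (cong length (trans (List.filter-++ S? ys zs) (cong (_++ filter S? zs) (List.filter-none S? ¬sys))))
      len≡ : length xs ≡ y + length zs
      len≡ = trans (↭-length σ) (List.length-++ ys)
      R≡ : count R? xs ≡ y + count R? zs
      R≡ = trans (↭-length (filter-↭ R? σ))
        (trans (cong length (trans (List.filter-++ R? ys zs) (cong (_++ filter R? zs) (List.filter-all R? rys))))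
               (List.length-++ ys))

-- Connected components

-- The relation generated by a list of edges is built one edge at a time, which
-- makes its decidability evident; for the list of all edges it is Joined.
module _ {n : ℕ} where

  Linked : List (Subset n) → Fin n → Fin n → Set
  Linked []       u v = u ≡ v
  Linked (e ∷ es) u v = Linked es u v ⊎
    (∃ λ x → x ∈ e × Linked es u x) × (∃ λ y → y ∈ e × Linked es y v)

  linked? : ∀ es u v → Dec (Linked es u v)
  linked? []       u v = u Fin.≟ v
  linked? (e ∷ es) u v = linked? es u v ⊎-dec
    (Fin.any? (λ x → (x ∈? e) ×-dec linked? es u x) ×-dec
     Fin.any? (λ y → (y ∈? e) ×-dec linked? es y v))

  linked-refl : ∀ es {u} → Linked es u u
  linked-refl []       = refl
  linked-refl (e ∷ es) = inj₁ (linked-refl es)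

  linked-sym : ∀ es {u v} → Linked es u v → Linked es v u
  linked-sym []       u≡v = sym u≡v
  linked-sym (e ∷ es) (inj₁ uv) = inj₁ (linked-sym es uv)
  linked-sym (e ∷ es) (inj₂ ((x , x∈ , ux) , (y , y∈ , yv))) =
    inj₂ ((y , y∈ , linked-sym es yv) , (x , x∈ , linked-sym es ux))

  linked-trans : ∀ es {u v w} → Linked es u v → Linked es v w → Linked es u w
  linked-trans []       u≡v v≡w = trans u≡v v≡w
  linked-trans (e ∷ es) (inj₁ uv) (inj₁ vw) = inj₁ (linked-trans es uv vw)
  linked-trans (e ∷ es) (inj₁ uv) (inj₂ ((x , x∈ , vx) , yw)) =
    inj₂ ((x , x∈ , linked-trans es uv vx) , yw)
  linked-trans (e ∷ es) (inj₂ (ux , (y , y∈ , yv))) (inj₁ vw) =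
    inj₂ (ux , (y , y∈ , linked-trans es yv vw))
  -- Both halves pass through `e`, so the detour between the two visits is dropped.
  linked-trans (e ∷ es) (inj₂ (ux , _)) (inj₂ (_ , yw)) = inj₂ (ux , yw)

  edge-linked : ∀ {es e u v} → e List.∈ es → u ∈ e → v ∈ e → Linked es u v
  edge-linked {e ∷ es} (here refl) u∈ v∈ =
    inj₂ ((_ , u∈ , linked-refl es) , (_ , v∈ , linked-refl es))
  edge-linked {e ∷ es} (there e∈) u∈ v∈ = inj₁ (edge-linked e∈ u∈ v∈)

module _ {n : ℕ} (H : Hypergraph n) where

  joined-trans : ∀ {u v w} → Joined H u v → Joined H v w → Joined H u w
  joined-trans (inj₁ refl) vw = vw
  joined-trans (inj₂ uv) (inj₁ refl) = inj₂ uv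
  joined-trans (inj₂ (e , f , u∈e , v∈f , p)) (inj₂ (e′ , f′ , v∈e′ , w∈f′ , p′)) =
    inj₂ (e , f′ , u∈e , w∈f′ , p ◅◅ ((_ , x∈p∩q⁺ (v∈f , v∈e′)) ◅ p′))

  linked⇒joined : ∀ {es u v} → All H es → Linked es u v → Joined H u v
  linked⇒joined []        u≡v = inj₁ u≡v
  linked⇒joined (h ∷ hes) (inj₁ uv) = linked⇒joined hes uv
  linked⇒joined (h ∷ hes) (inj₂ ((x , x∈ , ux) , (y , y∈ , yv))) =
    joined-trans (linked⇒joined hes ux)
      (joined-trans (inj₂ ((_ , h) , (_ , h) , x∈ , y∈ , ε)) (linked⇒joined hes yv))

module Components {n : ℕ} {H : Hypergraph n} (H? : Decidable H) where

  edges : List (Subset n)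
  edges = filter H? (subsets n)

  infix 4 _∼_
  _∼_ : Fin n → Fin n → Set
  _∼_ = Linked edges

  _∼?_ : ∀ u v → Dec (u ∼ v)
  _∼?_ = linked? edges

  ∼-refl : ∀ {u} → u ∼ u
  ∼-refl = linked-refl edges

  ∼-sym : ∀ {u v} → u ∼ v → v ∼ u
  ∼-sym = linked-sym edges

  ∼-trans : ∀ {u v w} → u ∼ v → v ∼ w → u ∼ w
  ∼-trans = linked-trans edges

  edge-∼ : ∀ {e u v} → H e → u ∈ e → v ∈ e → u ∼ v
  edge-∼ {e} h = edge-linked (∈-filter⁺ H? (∈-subsets e) h)

  ∼⇒joined : ∀ {u v} → u ∼ v → Joined H u v
  ∼⇒joined = linked⇒joined H (All.all-filter H? (subsets n))

  joined⇒∼ : ∀ {u v} → Joined H u v → u ∼ v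
  joined⇒∼ (inj₁ refl) = ∼-refl
  joined⇒∼ (inj₂ (e , f , u∈e , v∈f , p)) = walk e p u∈e v∈f
    where
    walk : ∀ e {f u v} → Star (Meets H) e f → u ∈ proj₁ e → v ∈ proj₁ f → u ∼ v
    walk e ε u∈e v∈e = edge-∼ (proj₂ e) u∈e v∈e
    walk e (_◅_ {j = e′} (x , x∈) p) u∈e v∈f with x∈e , x∈e′ ← x∈p∩q⁻ _ _ x∈ =
      ∼-trans (edge-∼ (proj₂ e) u∈e x∈e) (walk e′ p x∈e′ v∈f)

  component : Fin n → Subset n
  component u = tabulate (does ∘ (u ∼?_))

  ∈-component : ∀ {u v} → u ∼ v → v ∈ component u
  ∈-component {u} = ∈-tabulate-does⁺ (u ∼?_)

  component-isComponent : ∀ u → IsComponent H (component u)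
  component-isComponent u = (u , ∈-component ∼-refl) , λ v w v∈ →
    mk⇔ (λ w∈ → ∼⇒joined (∼-trans (∼-sym (∈⇒∼ v∈)) (∈⇒∼ w∈)))
        (λ vw → ∈-component (∼-trans (∈⇒∼ v∈) (joined⇒∼ vw)))
    where
    ∈⇒∼ : ∀ {v} → v ∈ component u → u ∼ v
    ∈⇒∼ = ∈-tabulate-does⁻ (u ∼?_)

-- The partition matroid of the classes

module _ {n r : ℕ} (ℓ : ℕ) (part : Fin n → Fin r) where

  Valid : Subset n → Set
  Valid p = ∀ i → ∣ p ∩ class part i ∣ ≤ ℓ

  completePartite? : Decidable (CompletePartite ℓ part)
  completePartite? e = (∣ e ∣ ℕ.≟ r) ×-dec Fin.all? (λ i → ∣ e ∩ class part i ∣ ≤? ℓ)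

  ∈-class⁺ : ∀ {v i} → part v ≡ i → v ∈ class part i
  ∈-class⁺ {i = i} = ∈-tabulate-does⁺ (λ v → part v Fin.≟ i)

  ∈-class⁻ : ∀ {v i} → v ∈ class part i → part v ≡ i
  ∈-class⁻ {i = i} = ∈-tabulate-does⁻ (λ v → part v Fin.≟ i)

  extend-valid : ∀ S {x} → Valid S → ∣ S ∩ class part (part x) ∣ < ℓ → Valid (S ∪ ⁅ x ⁆)
  extend-valid S {x} S-ok room i with part x Fin.≟ i
  ... | yes refl = begin
    ∣ (S ∪ ⁅ x ⁆) ∩ class part (part x) ∣ ≤⟨ p⊆q⇒∣p∣≤∣q∣ sub ⟩
    ∣ (S ∩ class part (part x)) ∪ ⁅ x ⁆ ∣ ≤⟨ ∣p∪⁅x⁆∣≤1+∣p∣ (S ∩ class part (part x)) x ⟩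
    suc ∣ S ∩ class part (part x) ∣       ≤⟨ room ⟩
    ℓ                                     ∎
    where
    open ≤-Reasoning
    sub : (S ∪ ⁅ x ⁆) ∩ class part (part x) ⊆ (S ∩ class part (part x)) ∪ ⁅ x ⁆
    sub y∈ with y∈∪ , y∈C ← x∈p∩q⁻ _ _ y∈ =
      x∈p∪q⁺ ([ (λ y∈S → inj₁ (x∈p∩q⁺ (y∈S , y∈C))) , inj₂ ]′ (x∈p∪q⁻ S _ y∈∪))
  ... | no x∉i = ≤-trans (p⊆q⇒∣p∣≤∣q∣ sub) (S-ok i)
    where
    sub : (S ∪ ⁅ x ⁆) ∩ class part i ⊆ S ∩ class part i
    sub y∈ with y∈∪ , y∈C ← x∈p∩q⁻ _ _ y∈ with x∈p∪q⁻ S _ y∈∪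
    ... | inj₁ y∈S = x∈p∩q⁺ (y∈S , y∈C)
    ... | inj₂ y∈x = contradiction (trans (cong part (sym (x∈⁅y⁆⇒x≡y x y∈x))) (∈-class⁻ y∈C)) x∉i

  -- The exchange property of the partition matroid, where the larger independent
  -- set is only known through the number f i of its elements in each class.
  augment : ∀ {S} T (f : Fin r → ℕ) → (∀ i → f i ≤ ℓ) → (∀ i → f i ≤ ∣ T ∩ class part i ∣) →
            Valid S → ∣ S ∣ < sum f → ∃ λ x → x ∈ T × x ∉ S × Valid (S ∪ ⁅ x ⁆)
  augment {S} T f f≤ℓ f≤T S-ok S<f
    with Fin.any? (λ x → (x ∈? T) ×-dec ¬? (x ∈? S) ×-dec (suc ∣ S ∩ class part (part x) ∣ ≤? ℓ))
  ... | yes (x , x∈T , x∉S , room) = x , x∈T , x∉S , extend-valid S S-ok room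
  ... | no none = contradiction S<f
          (≤⇒≯ (≤-trans (sum-mono f≤S) (≤-reflexive (sum-∩-class part S))))
    where
    -- If nothing can be added, each class is full in `S` or has all its vertices of `T` in `S`;
    -- summing over the classes contradicts `∣ S ∣ < sum f`.
    f≤S : ∀ i → f i ≤ ∣ S ∩ class part i ∣
    f≤S i with suc ∣ S ∩ class part i ∣ ≤? ℓ
    ... | no full  = ≤-trans (f≤ℓ i) (≮⇒≥ full)
    ... | yes room = ≤-trans (f≤T i) (p⊆q⇒∣p∣≤∣q∣ sub)
      where
      sub : T ∩ class part i ⊆ S ∩ class part i
      sub {y} y∈ with y∈T , y∈C ← x∈p∩q⁻ T _ y∈ | y ∈? S
      ... | yes y∈S = x∈p∩q⁺ (y∈S , y∈C)
      ... | no y∉S  = contradiction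
        (y , y∈T , y∉S , subst (λ j → ∣ S ∩ class part j ∣ < ℓ) (sym (∈-class⁻ y∈C)) room) none

-- Covering by at most `q` components

module Cover {n r ℓ k : ℕ} (part : Fin n → Fin r) (surj : StrictlySurjective _≡_ part)
  (c : Colouring (CompletePartite ℓ part) k) (spanning : Spanning c)
  (q : ℕ) (1≤q : 1 ≤ q) (3≤r : 3 ≤ r) (2≤ℓ : 2 ≤ ℓ) (ℓ≤r : ℓ ≤ r) (k≤ : k ≤ ℓ * q + (r ∸ ℓ)) where

  colourClass? : ∀ i → Decidable (colourClass c i)
  colourClass? i e with completePartite? ℓ part e
  ... | no ¬p = no (λ (p , _) → ¬p p)
  ... | yes p with c e p Fin.≟ i
  ...   | yes eq = yes (p , eq)
  -- `c` takes its membership proof irrelevantly, so `eq` is refuted whichever proof it comes with.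
  ...   | no ¬eq = no (λ (_ , eq) → ¬eq eq)

  module C i = Components (colourClass? i)

  infix 4 _∼[_]_
  _∼[_]_ : Fin n → Fin k → Fin n → Set
  u ∼[ i ] v = C._∼_ i u v

  -- Either the components of `u` in the colours of `I` cover, or a vertex avoiding them all goes to
  -- the continuation. Keeping `CoveredBy c q` as the goal makes the argument by contradiction
  -- constructive.
  away : ∀ u (I : List (Fin k)) → length I ≤ q →
         (∀ w → All (λ i → ¬ u ∼[ i ] w) I → CoveredBy c q) → CoveredBy c q
  away u I I≤q continue with Fin.all? (λ w → Any.any? (λ i → C._∼?_ i u w) I)
  ... | yes cover = List.map (λ i → C.component i u) I
                  , ≤-trans (≤-reflexive (List.length-map _ I)) I≤q
                  , All.map⁺ (All.universal (λ i → i , C.component-isComponent i u) I)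
                  , λ v → Any.map⁺ (Any.map (λ {i} → C.∈-component i) (cover v))
  ... | no ¬cover
    with w , ¬any ← Fin.¬∀⟶∃¬ n _ (λ w → Any.any? (λ i → C._∼?_ i u w) I) ¬cover =
    continue w (All.¬Any⇒All¬ I ¬any)

  Separated : Subset n → Fin n → Fin k → Set
  Separated S s i = ∃ λ x → x ∈ S × ¬ s ∼[ i ] x

  -- `L` holds the colours still to be treated. All separations start from one vertex `base`, so
  -- that `away` spends one component per colour.
  record SeparatedOutside (S : Subset n) (L : List (Fin k)) : Set where
    constructor separatedOutside
    field
      base      : Fin n
      base∈     : base ∈ S
      separated : ∀ i → i List.∈ L ⊎ Separated S base i

  separated-∪ : ∀ {S T s i} → Separated S s i → Separated (S ∪ T) s i
  separated-∪ (x , x∈ , ¬sx) = x , x∈p∪q⁺ (inj₁ x∈) , ¬sx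

  -- Exchange with a transversal: the classes are nonempty, so one vertex from each gives `r` in
  -- total.
  fresh : ∀ S → Valid ℓ part S → ∣ S ∣ < r → ∃ λ x → x ∉ S × Valid ℓ part (S ∪ ⁅ x ⁆)
  fresh S S-ok S<r =
    let x , _ , x∉S , ok = augment ℓ part Subset.⊤ (λ _ → 1) (λ _ → ≤-trans (s≤s z≤n) 2≤ℓ) meets
                             S-ok (≤-trans S<r (≤-reflexive (sym (sum-const-1 r))))
    in x , x∉S , ok
    where
    meets : ∀ i → 1 ≤ ∣ Subset.⊤ ∩ class part i ∣
    meets i with v , pv≡i ← surj i = ≤-trans (≤-reflexive (sym (∣⁅x⁆∣≡1 v)))
      (p⊆q⇒∣p∣≤∣q∣ λ y∈ → x∈p∩q⁺ (∈⊤ , ∈-class⁺ ℓ part (trans (cong part (x∈⁅y⁆⇒x≡y v y∈)) pv≡i)))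

  -- A vertex joined to s in colour b witnesses that b is used, so that by the
  -- spanning property the component missed by s contains an edge.
  separate : ∀ b {S s} → s ∈ S → Valid ℓ part S → ∣ S ∣ < r →
             (∀ x → x ∉ S → Valid ℓ part (S ∪ ⁅ x ⁆) → ¬ s ∼[ b ] x → CoveredBy c q) → CoveredBy c q
  separate b {S} {s} s∈S S-ok S<r continue with fresh S S-ok S<r
  ... | x , x∉S , ok with C._∼?_ b s x
  ...   | no ¬sx = continue x x∉S ok ¬sx
  ...   | yes sx with C.∼⇒joined b sx
  ...     | inj₁ refl = contradiction s∈S x∉S
  ...     | inj₂ (used , _) = away s (b ∷ []) 1≤q through
    where
    through : ∀ w → All (λ i → ¬ s ∼[ i ] w) (b ∷ []) → CoveredBy c q
    through w (¬sw ∷ [])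
      with e , h@((∣e∣≡r , e-ok) , _) , w∈e ← spanning b used w
      with y , y∈e , y∉S , ok ← augment ℓ part e (λ i → ∣ e ∩ class part i ∣) e-ok (λ _ → ≤-refl) S-ok
             (≤-trans S<r (≤-reflexive (sym (trans (sum-∩-class part e) ∣e∣≡r)))) =
      continue y y∉S ok (λ sy → ¬sw (C.∼-trans b sy (C.edge-∼ b h y∈e w∈e)))

  -- Each of the `j` missing vertices removes one colour from `L`, or is arbitrary once `L` is
  -- empty. At size `r` the set is an edge, and its own colour joins two vertices which that colour
  -- separates.
  complete : ∀ j S {L} → ∣ S ∣ + j ≡ r → Valid ℓ part S → length L ≤ j →
             SeparatedOutside S L → CoveredBy c q
  complete zero S {[]} ∣S∣≡r S-ok _ (separatedOutside s s∈S sep)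
    with edge ← (trans (sym (+-identityʳ _)) ∣S∣≡r , S-ok) | sep (c S edge)
  ... | inj₂ (x , x∈S , ¬sx) = ⊥-elim (¬sx (C.edge-∼ (c S edge) (edge , refl) s∈S x∈S))
  complete (suc j) S {L} ∣S∣≡r S-ok L≤j (separatedOutside s s∈S sep) = go L L≤j sep
    where
    S<r : ∣ S ∣ < r
    S<r = ≤-trans (m≤m+n _ j) (≤-reflexive (trans (sym (+-suc _ j)) ∣S∣≡r))
    size : ∀ {x} → x ∉ S → ∣ S ∪ ⁅ x ⁆ ∣ + j ≡ r
    size x∉S = trans (cong (_+ j) (x∉p⇒∣p∪⁅x⁆∣≡1+∣p∣ x∉S)) (trans (sym (+-suc _ j)) ∣S∣≡r)
    go : ∀ L → length L ≤ suc j → (∀ i → i List.∈ L ⊎ Separated S s i) → CoveredBy c q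
    go [] _ sep with x , x∉S , ok ← fresh S S-ok S<r =
      complete j _ {[]} (size x∉S) ok z≤n
        (separatedOutside s (x∈p∪q⁺ (inj₁ s∈S)) (λ i → inj₂ (separated-∪ ([ (λ ()) , id ]′ (sep i)))))
    go (b ∷ L) L≤ sep = separate b s∈S S-ok S<r λ x x∉S ok ¬sx →
      complete j _ (size x∉S) ok (≤-pred L≤) (separatedOutside s (x∈p∪q⁺ (inj₁ s∈S)) (step x ¬sx))
      where
      step : ∀ x → ¬ s ∼[ b ] x → ∀ i → i List.∈ L ⊎ Separated (S ∪ ⁅ x ⁆) s i
      step x ¬sx i with sep i
      ... | inj₁ (here refl) = inj₂ (x , x∈p∪q⁺ (inj₂ (x∈⁅x⁆ x)) , ¬sx)
      ... | inj₁ (there i∈)  = inj₁ i∈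
      ... | inj₂ s-sep       = inj₂ (separated-∪ s-sep)

  -- Each of `t` further vertices removes up to `q` colours from `L`. While `∣ S ∣ ≤ ℓ` their
  -- classes are irrelevant, and the last `r ∸ ℓ` colours fit into the `r ∸ ∣ S ∣` places left for
  -- `complete`.
  fill : ∀ t S {L} → ∣ S ∣ + t ≤ ℓ → length L ≤ t * q + (r ∸ ℓ) → SeparatedOutside S L → CoveredBy c q
  fill zero S S≤ℓ L≤ sep =
    complete (r ∸ ∣ S ∣) S (m+[n∸m]≡n (≤-trans S≤ℓ′ ℓ≤r)) (λ i → ≤-trans (∣p∩q∣≤∣p∣ S _) S≤ℓ′)
      (≤-trans L≤ (∸-monoʳ-≤ r S≤ℓ′)) sep
    where
    S≤ℓ′ : ∣ S ∣ ≤ ℓ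
    S≤ℓ′ = ≤-trans (m≤m+n _ 0) S≤ℓ
  fill (suc t) S {L} S≤ℓ L≤ (separatedOutside s s∈S sep) =
    away s (take q L) (≤-trans (≤-reflexive (List.length-take q L)) (m⊓n≤m q _)) λ w w-away →
      -- `w` may already lie in `S`, so only an upper bound on the size is kept.
      fill t (S ∪ ⁅ w ⁆) (≤-trans (+-monoˡ-≤ t (∣p∪⁅x⁆∣≤1+∣p∣ S w)) (≤-trans (≤-reflexive (sym (+-suc _ t))) S≤ℓ))
        (≤-trans (≤-reflexive (List.length-drop q L)) (m≤n+o⇒m∸n≤o _ q (≤-trans L≤ (≤-reflexive (+-assoc q _ _)))))
        (separatedOutside s (x∈p∪q⁺ (inj₁ s∈S)) (step w w-away))
    where
    step : ∀ w → All (λ i → ¬ s ∼[ i ] w) (take q L) →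
           ∀ i → i List.∈ drop q L ⊎ Separated (S ∪ ⁅ w ⁆) s i
    step w w-away i with sep i
    ... | inj₂ s-sep = inj₂ (separated-∪ s-sep)
    ... | inj₁ i∈L with ∈-++⁻ (take q L) (subst (i List.∈_) (sym (List.take++drop≡id q L)) i∈L)
    ...   | inj₁ i∈ = inj₂ (w , x∈p∪q⁺ (inj₂ (x∈⁅x⁆ w)) , All.lookup w-away i∈)
    ...   | inj₂ i∈ = inj₁ i∈

  -- Pairs of vertices and the colours joining them

  joining : Fin n → Fin n → List (Fin k)
  joining u v = filter (λ i → C._∼?_ i u v) (allFin k)

  ∈-joining : ∀ {u v i} → u ∼[ i ] v → i List.∈ joining u v
  ∈-joining {u} {v} {i} = ∈-filter⁺ (λ i → C._∼?_ i u v) (∈-allFin i)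

  pair : ∀ (u v : Fin n) → ∣ ⁅ u ⁆ ∪ ⁅ v ⁆ ∣ ≤ 2
  pair u v = ≤-trans (∣p∪⁅x⁆∣≤1+∣p∣ ⁅ u ⁆ v) (s≤s (≤-reflexive (∣⁅x⁆∣≡1 u)))

  -- Two of the `ℓ` places are taken; the hypothesis leaves as many colours as `fill` can treat with
  -- the other `ℓ ∸ 2`.
  from-pair : ∀ u v → length (joining u v) + (q + q) ≤ k → CoveredBy c q
  from-pair u v few = fill (ℓ ∸ 2) (⁅ u ⁆ ∪ ⁅ v ⁆)
    (≤-trans (+-monoˡ-≤ (ℓ ∸ 2) (pair u v)) (≤-reflexive (m+[n∸m]≡n 2≤ℓ)))
    bound (separatedOutside u (x∈p∪q⁺ (inj₁ (x∈⁅x⁆ u))) sep)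
    where
    sep : ∀ i → i List.∈ joining u v ⊎ Separated (⁅ u ⁆ ∪ ⁅ v ⁆) u i
    sep i with C._∼?_ i u v
    ... | yes uv = inj₁ (∈-joining uv)
    ... | no ¬uv = inj₂ (v , x∈p∪q⁺ (inj₂ (x∈⁅x⁆ v)) , ¬uv)
    rearrange : ∀ t q a → (2 + t) * q + a ≡ t * q + a + (q + q)
    rearrange = solve-∀
    bound : length (joining u v) ≤ (ℓ ∸ 2) * q + (r ∸ ℓ)
    bound = +-cancelʳ-≤ (q + q) _ _ (begin
      length (joining u v) + (q + q)      ≤⟨ few ⟩
      k                                   ≤⟨ k≤ ⟩
      ℓ * q + (r ∸ ℓ)                     ≡⟨ cong (λ l → l * q + (r ∸ ℓ)) (m+[n∸m]≡n 2≤ℓ) ⟨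
      (2 + (ℓ ∸ 2)) * q + (r ∸ ℓ)         ≡⟨ rearrange (ℓ ∸ 2) q (r ∸ ℓ) ⟩
      (ℓ ∸ 2) * q + (r ∸ ℓ) + (q + q)     ∎)
      where open ≤-Reasoning

  -- A vertex `w` avoiding `u` in every colour that joins `u` and `v` makes the triple separated in
  -- all colours.
  from-triple : ∀ u v → part u ≢ part v → length (joining u v) ≤ q → CoveredBy c q
  from-triple u v u≁v few = away u (joining u v) few λ w w-away →
    let S = (⁅ u ⁆ ∪ ⁅ v ⁆) ∪ ⁅ w ⁆
        S≤3 : ∣ S ∣ ≤ 3
        S≤3 = ≤-trans (∣p∪⁅x⁆∣≤1+∣p∣ (⁅ u ⁆ ∪ ⁅ v ⁆) w) (s≤s (pair u v))
        u∈S : u ∈ S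
        u∈S = x∈p∪q⁺ (inj₁ (x∈p∪q⁺ (inj₁ (x∈⁅x⁆ u))))
        v∈S : v ∈ S
        v∈S = x∈p∪q⁺ (inj₁ (x∈p∪q⁺ (inj₂ (x∈⁅x⁆ v))))
        -- A class missing one of at most three vertices contains at most two of them, and `2 ≤ ℓ`.
        miss : ∀ {x i} → x ∈ S → part x ≢ i → ∣ S ∩ class part i ∣ ≤ ℓ
        miss {x} {i} x∈S x∉i = ≤-trans (≤-pred (≤-trans (s≤s (p⊆q⇒∣p∣≤∣q∣ {q = S Subset.- x} λ y∈ →
            let y∈S , y∈C = x∈p∩q⁻ S _ y∈ in
            x∈p∧x≢y⇒x∈p-y y∈S (λ { refl → x∉i (∈-class⁻ ℓ part y∈C) })))
          (≤-trans (x∈p⇒∣p-x∣<∣p∣ x∈S) S≤3))) 2≤ℓ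
        S-ok : Valid ℓ part S
        S-ok i = [ miss u∈S , miss v∈S ]′ (outside-one i)
        sep : ∀ i → i List.∈ [] ⊎ Separated S u i
        sep i = inj₂ (apart i w w-away)
    in complete (r ∸ ∣ S ∣) S {[]} (m+[n∸m]≡n (≤-trans S≤3 3≤r)) S-ok z≤n (separatedOutside u u∈S sep)
    where
    outside-one : ∀ i → part u ≢ i ⊎ part v ≢ i
    outside-one i with part u Fin.≟ i
    ... | no u≢i   = inj₁ u≢i
    ... | yes refl = inj₂ (u≁v ∘ sym)
    apart : ∀ i w → All (λ i → ¬ u ∼[ i ] w) (joining u v) → Separated ((⁅ u ⁆ ∪ ⁅ v ⁆) ∪ ⁅ w ⁆) u i
    apart i w w-away with C._∼?_ i u v
    ... | no ¬uv = v , x∈p∪q⁺ (inj₁ (x∈p∪q⁺ (inj₂ (x∈⁅x⁆ v)))) , ¬uv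
    ... | yes uv = w , x∈p∪q⁺ (inj₂ (x∈⁅x⁆ w)) , All.lookup w-away (∈-joining uv)

  -- A colour joining `w` to both `u` and `v` joins `u` to `v`. A colour of `I` joins `u` to `v` but
  -- not to `w`, hence does not join `v` to `w` either.
  joining-bound : ∀ {u v w I J} → allFin k ↭ I ++ J → length I ≡ q →
    All (λ i → u ∼[ i ] v) I → All (λ i → ¬ u ∼[ i ] w) I →
    length (joining u w) + length (joining v w) + (q + q) ≤ k + length (joining u v)
  joining-bound {u} {v} {w} {I} σ refl uv ¬uw = ≤-trans
    (count-∩-split (λ i → C._∼?_ i u w) (λ i → C._∼?_ i v w) (λ i → C._∼?_ i u v)
      (λ {i} uw vw → C.∼-trans i uw (C.∼-sym i vw)) σ uv ¬uw
      (All.zipWith (λ {i} (¬uw , uv) vw → ¬uw (C.∼-trans i uv vw)) (¬uw , uv)))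
    (≤-reflexive (cong (_+ length (joining u v)) (List.length-tabulate {n = k} id)))

  -- Well-founded descent on the number of joining colours takes the place of choosing a minimal
  -- pair.
  from-cross-pair : ∀ u v → part u ≢ part v → Acc _<_ (length (joining u v)) → CoveredBy c q
  from-cross-pair u v u≁v (acc rec) with ≤-total (length (joining u v)) q
  ... | inj₁ few = from-triple u v u≁v few
  ... | inj₂ many
    with I , J , σ , ∣I∣≡q , uv ← split-filter (λ i → C._∼?_ i u v) q (allFin k) many =
    away u I (≤-reflexive ∣I∣≡q) next
    where
    -- `x` is the one of `u`, `v` known to differ in class from `w`, and `y` is the other. If `x`,
    -- `w` is not a smaller pair, cancelling in the bound makes `from-pair` apply to `y`, `w`.
    choose : ∀ {a b} w x y → part x ≢ part w → a ≡ length (joining x w) → b ≡ length (joining y w) →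
             a + b + (q + q) ≤ k + length (joining u v) → CoveredBy c q
    choose w x y x≁w refl refl bound with length (joining u v) ≤? length (joining x w)
    ... | no more = from-cross-pair x w x≁w (rec (≰⇒> more))
    ... | yes less = from-pair y w (+-cancelˡ-≤ (length (joining u v)) _ _ (begin
      a₀ + (b + (q + q)) ≤⟨ +-monoˡ-≤ _ less ⟩
      a + (b + (q + q))  ≡⟨ +-assoc a b _ ⟨
      a + b + (q + q)    ≤⟨ bound ⟩
      k + a₀             ≡⟨ +-comm k a₀ ⟩
      a₀ + k             ∎))
      where
      open ≤-Reasoning
      a₀ = length (joining u v)
      a = length (joining x w)
      b = length (joining y w)
    next : ∀ w → All (λ i → ¬ u ∼[ i ] w) I → CoveredBy c q
    next w ¬uw with part u Fin.≟ part w
    ... | no u≁w = choose w u v u≁w refl refl (joining-bound σ ∣I∣≡q uv ¬uw)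
    ... | yes u≈w = choose w v u (λ v≈w → u≁v (trans u≈w (sym v≈w))) refl refl
      (≤-trans (≤-reflexive (cong (_+ (q + q)) (+-comm (length (joining v w)) _)))
               (joining-bound σ ∣I∣≡q uv ¬uw))

  two-classes : ∀ {r} {part : Fin n → Fin r} → 3 ≤ r → StrictlySurjective _≡_ part →
                ∃₂ λ u v → part u ≢ part v
  two-classes (s≤s (s≤s _)) surj with u , pu ← surj zero | v , pv ← surj (suc zero) =
    u , v , λ eq → Fin.0≢1+n (trans (sym pu) (trans eq pv))

  covered : CoveredBy c q
  covered with u , v , u≁v ← two-classes 3≤r surj = from-cross-pair u v u≁v (<-wellFounded _)

-- The remainder is below `ℓ`, so the extra `ℓ` from the leading 1 absorbs both it and the
-- subtracted 1.
k≤ℓq+a : ∀ ℓ k a .{{_ : NonZero ℓ}} → k ≤ ℓ * (1 + (k ∸ a ∸ 1) / ℓ) + a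
k≤ℓq+a ℓ k a = begin
  k                           ≤⟨ m≤n+m∸n k a ⟩
  a + (k ∸ a)                 ≤⟨ +-monoʳ-≤ a (m≤n+m∸n (k ∸ a) 1) ⟩
  a + suc m                   ≡⟨ cong (λ x → a + suc x) (m≡m%n+[m/n]*n m ℓ) ⟩
  a + suc (m % ℓ + m / ℓ * ℓ) ≤⟨ +-monoʳ-≤ a (+-monoˡ-≤ (m / ℓ * ℓ) (m%n<n m ℓ)) ⟩
  a + (ℓ + m / ℓ * ℓ)         ≡⟨ +-comm a _ ⟩
  (1 + m / ℓ) * ℓ + a         ≡⟨ cong (_+ a) (*-comm (1 + m / ℓ) ℓ) ⟩
  ℓ * (1 + m / ℓ) + a         ∎
  where
  open ≤-Reasoning
  m = k ∸ a ∸ 1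

-- The first half asserts the bound without presupposing that the minimum exists; the second
-- transfers it to any value of `cov`. Under the hypotheses the truncated subtractions are exact.
theorem3p4 : ∀ (r ℓ k : ℕ) .{{_ : NonZero ℓ}} → r ≥ 3 → 2 ≤ ℓ → ℓ ≤ r → k ≥ 1 + (r ∸ ℓ) →
    AlwaysCoveredBy r ℓ k (1 + (k ∸ (r ∸ ℓ) ∸ 1) / ℓ)
    × (∀ m → IsCov r ℓ k m → m ≤ 1 + (k ∸ (r ∸ ℓ) ∸ 1) / ℓ)
theorem3p4 r ℓ k r≥3 2≤ℓ ℓ≤r _ = always , λ m isCov → proj₂ isCov _ always
  where
  always : AlwaysCoveredBy r ℓ k (1 + (k ∸ (r ∸ ℓ) ∸ 1) / ℓ)
  always part surj c spanning =
    Cover.covered part surj c spanning _ (s≤s z≤n) r≥3 2≤ℓ ℓ≤r (k≤ℓq+a ℓ k (r ∸ ℓ))
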